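{- Let $R(x,y)=\sum_{n,k\ge1}r_{n,k}x^ny^k$, where $r_{n,k}$ is the number of Schroeder trees with $n$ leaves and exactly $k$ vertices in total (leaves included). Then $$R(x,y)=\frac{1+xy-\sqrt{(xy)^2+2xy+1-4xy(y+1)}}{2y+2}.$$
   Context: A Schroeder tree is a finite rooted plane tree (the children of each vertex are linearly ordered) in which every non-leaf vertex has at least two children. A leaf is a vertex with no children; the one-vertex tree is a Schroeder tree with one leaf. Trees are counted up to isomorphism of rooted plane trees. The square root denotes the formal power series square root in $\mathbb{Q}[[x,y]]$ with constant term $1$. -}

module Defs where

open import Algebra.Bundles using (CommutativeRing)
open import Data.Fin.Base using (toℕ)
open import Data.List.Base using (List; []; _∷_; map; filter; length; cartesianProductWith)
open import Data.List.Membership.Propositional using (_∈_)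
open import Data.List.Membership.Propositional.Properties
  using (∈-map⁺; ∈-filter⁺; ∈-filter⁻; ∈-cartesianProductWith⁺; ∈-cartesianProductWith⁻)
open import Data.List.Relation.Unary.All using (All; []; _∷_)
open import Data.List.Relation.Unary.AllPairs using ([]; _∷_)
open import Data.List.Relation.Unary.Any using (here; there)
open import Data.List.Relation.Unary.Unique.Propositional using (Unique)
open import Data.List.Relation.Unary.Unique.Propositional.Properties
  using (map⁺; filter⁺; cartesianProductWith⁺)
open import Data.Integer.Base using (+_)
open import Data.Nat.Base as ℕ using (ℕ; zero; suc; _∸_; _≤_; z≤n; s≤s)
import Data.Nat.Properties as ℕ
open import Data.Product.Base using (_×_; _,_; proj₂)
open import Data.Rational.Base as ℚ using (ℚ; 0ℚ; 1ℚ)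
import Data.Rational.Properties as ℚ
open import Data.Sum.Base using (_⊎_; inj₁; inj₂)
open import Function.Bundles using (_⇔_; mk⇔)
open import Relation.Binary.PropositionalEquality using (_≡_; refl; _≢_)
open import Relation.Nullary.Decidable using (Dec; yes; no; map′; _×-dec_; _⊎-dec_)

open import Algebra.Properties.Semiring.Sum
  (CommutativeRing.semiring ℚ.+-*-commutativeRing) using (sum⁺-syntax)

-- A rooted plane tree is given by the ordered list of the subtrees at its
-- root, so isomorphism of rooted plane trees is propositional equality.
data Tree : Set where
  node : List Tree → Tree

vertices  : Tree → ℕ
vertices* : List Tree → ℕ
vertices (node ts) = suc (vertices* ts)
vertices* []       = 0
vertices* (t ∷ ts) = vertices t ℕ.+ vertices* ts

leaves  : Tree → ℕ
leaves* : List Tree → ℕ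
leaves (node [])         = 1
leaves (node (t ∷ ts))   = leaves t ℕ.+ leaves* ts
leaves* []       = 0
leaves* (t ∷ ts) = leaves t ℕ.+ leaves* ts

data IsSchroeder : Tree → Set where
  node : ∀ {ts} → ts ≡ [] ⊎ 2 ≤ length ts → All IsSchroeder ts → IsSchroeder (node ts)

isSchroeder?  : ∀ t → Dec (IsSchroeder t)
isSchroeder*? : ∀ ts → Dec (All IsSchroeder ts)
isSchroeder? (node ts) =
  map′ (λ (p , q) → node p q) (λ { (node p q) → p , q })
       ((empty? ts ⊎-dec 2 ℕ.≤? length ts) ×-dec isSchroeder*? ts)
  where
  empty? : (us : List Tree) → Dec (us ≡ [])
  empty? []      = yes refl
  empty? (_ ∷ _) = no λ ()
isSchroeder*? []       = yes []
isSchroeder*? (t ∷ ts) =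
  map′ (λ (p , q) → p ∷ q) (λ { (p ∷ q) → p , q })
       (isSchroeder? t ×-dec isSchroeder*? ts)

SchroederWith : ℕ → ℕ → Tree → Set
SchroederWith n k t = IsSchroeder t × leaves t ≡ n × vertices t ≡ k

schroederWith? : ∀ n k t → Dec (SchroederWith n k t)
schroederWith? n k t = isSchroeder? t ×-dec leaves t ℕ.≟ n ×-dec vertices t ℕ.≟ k

-- A finite list of distinct forests containing every forest with at most d
-- vertices (and some larger ones, which the filter in schroederTrees removes).
forests : ℕ → List (List Tree)
forests zero    = [] ∷ []
forests (suc d) =
  [] ∷ cartesianProductWith (λ us ts → node us ∷ ts) (forests d) (forests d)

-- By schroederTrees-unique and ∈-schroederTrees, every Schroeder tree with n
-- leaves and k vertices occurs in this list exactly once, and nothing else does.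
schroederTrees : ℕ → ℕ → List Tree
schroederTrees n k = filter (schroederWith? n k) (map node (forests k))

r : ℕ → ℕ → ℕ
r n k = length (schroederTrees n k)

forests-unique : ∀ d → Unique (forests d)
forests-unique zero    = [] ∷ []
forests-unique (suc d) =
  nonempty ∷ cartesianProductWith⁺ _ (λ { refl → refl , refl })
               (forests-unique d) (forests-unique d)
  where
  open import Data.List.Relation.Unary.All using (tabulate)
  nonempty : All ([] ≢_)
    (cartesianProductWith (λ us ts → node us ∷ ts) (forests d) (forests d))
  nonempty = tabulate λ v∈ []≡v →
    absurd []≡v (proj₂ (proj₂ (proj₂ (proj₂
      (∈-cartesianProductWith⁻ (λ us ts → node us ∷ ts) (forests d) (forests d) v∈)))))
    where
    open import Data.Empty using (⊥)
    absurd : ∀ {v ts : List Tree} {u} → [] ≡ v → v ≡ u ∷ ts → ⊥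
    absurd refl ()

forests-complete : ∀ d ts → vertices* ts ≤ d → ts ∈ forests d
forests-complete zero    []             _       = here refl
forests-complete zero    (node _ ∷ _)   ()
forests-complete (suc d) []             _       = here refl
forests-complete (suc d) (node us ∷ ts) (s≤s p) =
  there (∈-cartesianProductWith⁺ _
    (forests-complete d us (ℕ.m+n≤o⇒m≤o _ p))
    (forests-complete d ts (ℕ.m+n≤o⇒n≤o (vertices* us) p)))

schroederTrees-unique : ∀ n k → Unique (schroederTrees n k)
schroederTrees-unique n k =
  filter⁺ (schroederWith? n k) (map⁺ (λ { refl → refl }) (forests-unique k))

∈-schroederTrees : ∀ n k t → t ∈ schroederTrees n k ⇔ SchroederWith n k t
∈-schroederTrees n k t = mk⇔
  (λ t∈ → proj₂ (∈-filter⁻ (schroederWith? n k) {xs = map node (forests k)} t∈))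
  (λ p → ∈-filter⁺ (schroederWith? n k) (listed t p) p)
  where
  listed : ∀ t → SchroederWith n k t → t ∈ map node (forests k)
  listed (node ts) (_ , _ , refl) =
    ∈-map⁺ node (forests-complete (suc (vertices* ts)) ts (ℕ.n≤1+n _))

-- ℚ[[x,y]]: F n k is the coefficient of xⁿ yᵏ.
Series : Set
Series = ℕ → ℕ → ℚ

infix  4 _≈_
infixl 6 _⊕_ _⊖_
infixl 7 _⊗_
infixr 8 _^_

_≈_ : Series → Series → Set
F ≈ G = ∀ n k → F n k ≡ G n k

_⊕_ _⊖_ _⊗_ : Series → Series → Series
(F ⊕ G) n k = F n k ℚ.+ G n k
(F ⊖ G) n k = F n k ℚ.- G n k
(F ⊗ G) n k =
  ∑[ i ≤ n ] ∑[ j ≤ k ] (F (toℕ i) (toℕ j) ℚ.* G (n ∸ toℕ i) (k ∸ toℕ j))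

const : ℕ → Series
const m zero zero = + m ℚ./ 1
const m _    _    = 0ℚ

_^_ : Series → ℕ → Series
F ^ zero  = const 1
F ^ suc m = F ⊗ F ^ m

x y : Series
x 1 0 = 1ℚ
x _ _ = 0ℚ
y 0 1 = 1ℚ
y _ _ = 0ℚ

IsSquareRoot : Series → Series → Set
IsSquareRoot F S = S ^ 2 ≈ F × S 0 0 ≡ 1ℚ

IsInverse : Series → Series → Set
IsInverse F V = F ⊗ V ≈ const 1

R : Series
R (suc n) (suc k) = + r (suc n) (suc k) ℚ./ 1
R _       _       = 0ℚ

{-# OPTIONS --safe #-}

-- Let T be the generating function of Schroeder trees and P that of finite
-- sequences of them, both with weight xˡᵉᵃᵛᵉˢ yᵛᵉʳᵗⁱᶜᵉˢ.  Splitting a sequence at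
-- its first tree gives P = 1 + T P.  A tree is a leaf or a root with a first
-- subtree and a nonempty sequence of further ones, so T = x y + T V with
-- V = y T P.  Eliminating V and P yields (1 + y) T² − (1 + x y) T + x y = 0, and
-- completing the square shows that 1 + x y − 2 (1 + y) T is the root of D.
-- The trees are enumerated in stages (forests d); the partial sums obey the same
-- equations as recurrences and stabilise modulo yᵈ⁺¹.
module Submission where

open import Algebra.Bundles using (CommutativeRing; RawRing)
import Algebra.Construct.Pointwise as Pointwise
import Algebra.Morphism.RingMonomorphism as RingMonomorphism
open import Algebra.Morphism.Structures using (IsRingMonomorphism)
import Algebra.Solver.Ring.NaturalCoefficients.Default as NaturalSolver
open import Algebra.Structures using (IsCommutativeRing)
open import Data.Fin.Base using (Fin; zero; suc; toℕ)
open import Data.Fin.Properties using (toℕ≤pred[n])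
open import Data.Integer.Base as ℤ using (+_)
import Data.Integer.Properties as ℤ
open import Data.List.Base using (List; []; _∷_; _++_; map; filter; length; cartesianProductWith)
open import Data.List.Properties using (filter-none)
open import Data.List.Relation.Unary.All as All using (All; []; _∷_)
open import Data.Nat.Base as ℕ using (ℕ; zero; suc; _∸_; _<_; _≤_; z≤n; s≤s)
import Data.Nat.Properties as ℕ
open import Data.Product using (_×_; _,_; ∃!)
open import Data.Rational.Base as ℚ using (ℚ; 0ℚ; 1ℚ; ½)
import Data.Rational.Properties as ℚ
import Data.Rational.Unnormalised.Base as ℚᵘ
import Data.Rational.Unnormalised.Properties as ℚᵘ
open import Data.Sum.Base using (inj₁; inj₂)
open import Function.Base using (_∘_; id)
open import Level using (0ℓ)
import Relation.Binary.PropositionalEquality as ≡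
import Relation.Binary.Reasoning.Setoid as ≈-Reasoning
open import Relation.Nullary using (¬_; yes; no; contradiction)
open import Relation.Unary using (Decidable)

-- Formal power series over a commutative ring

module PowerSeries {c ℓ} (A : CommutativeRing c ℓ) where

  open CommutativeRing A
  open import Algebra.Properties.Semiring.Sum semiring using (sum⁺-syntax)
  open import Algebra.Properties.AbelianGroup +-abelianGroup using (∙-cancelˡ)
  open NaturalSolver commutativeSemiring using (solve; _:+_; _:*_; _:=_; con)
  open ≈-Reasoning setoid

  infix  4 _≋_
  infixl 7 _⊛_

  _≋_ : (F G : ℕ → Carrier) → Set ℓ
  F ≋ G = ∀ n → F n ≈ G n

  -- As ∑[ i ≤ n ] is a right fold, (F ⊛ G) (suc n) is definitionally
  -- F 0 * G (suc n) + (F ∘ suc ⊛ G) n; all proofs below run on this recursion.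
  _⊛_ : (F G : ℕ → Carrier) → ℕ → Carrier
  (F ⊛ G) n = ∑[ i ≤ n ] (F (toℕ i) * G (n ∸ toℕ i))

  constant : Carrier → ℕ → Carrier
  constant a zero    = a
  constant a (suc n) = 0#

  ⊛-cong : ∀ {F F′ G G′} → F ≋ F′ → G ≋ G′ → F ⊛ G ≋ F′ ⊛ G′
  ⊛-cong F≋ G≋ zero    = +-congʳ (*-cong (F≋ 0) (G≋ 0))
  ⊛-cong F≋ G≋ (suc n) =
    +-cong (*-cong (F≋ 0) (G≋ (suc n))) (⊛-cong (F≋ ∘ suc) G≋ n)

  ⊛-congʳ : ∀ {F F′} G → F ≋ F′ → F ⊛ G ≋ F′ ⊛ G
  ⊛-congʳ G F≋ = ⊛-cong {G = G} F≋ (λ _ → refl)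

  ⊛-zeroˡ : ∀ F → (λ _ → 0#) ⊛ F ≋ λ _ → 0#
  ⊛-zeroˡ F zero    = solve 1 (λ a → con 0 :* a :+ con 0 := con 0) refl (F 0)
  ⊛-zeroˡ F (suc n) = begin
    0# * F (suc n) + ((λ _ → 0#) ⊛ F) n  ≈⟨ +-cong (zeroˡ _) (⊛-zeroˡ F n) ⟩
    0# + 0#                              ≈⟨ +-identityˡ 0# ⟩
    0#                                   ∎

  constant-⊛ : ∀ a F → constant a ⊛ F ≋ λ n → a * F n
  constant-⊛ a F zero    = +-identityʳ _
  constant-⊛ a F (suc n) = begin
    a * F (suc n) + ((λ _ → 0#) ⊛ F) n  ≈⟨ +-congˡ (⊛-zeroˡ F n) ⟩
    a * F (suc n) + 0#                  ≈⟨ +-identityʳ _ ⟩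
    a * F (suc n)                       ∎

  -- The mirror image of the definitional recursion: the last summand is split off instead of the
  -- first. Commutativity and cancellation both rest on it.
  ⊛-sucʳ : ∀ F G n → (F ⊛ G) (suc n) ≈ F (suc n) * G 0 + (F ⊛ (G ∘ suc)) n
  ⊛-sucʳ F G zero =
    solve 4 (λ a b c d → a :* d :+ (b :* c :+ con 0) := b :* c :+ (a :* d :+ con 0))
      refl (F 0) (F 1) (G 0) (G 1)
  ⊛-sucʳ F G (suc n) = begin
    a + (F ∘ suc ⊛ G) (suc n)      ≈⟨ +-congˡ (⊛-sucʳ (F ∘ suc) G n) ⟩
    a + (b + (F ∘ suc ⊛ G ∘ suc) n)
      ≈⟨ solve 3 (λ a b c → a :+ (b :+ c) := b :+ (a :+ c)) refl a b _ ⟩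
    b + (a + (F ∘ suc ⊛ G ∘ suc) n)  ∎
    where
    a = F 0 * G (suc (suc n))
    b = F (suc (suc n)) * G 0

  ⊛-comm : ∀ F G → F ⊛ G ≋ G ⊛ F
  ⊛-comm F G zero    = +-congʳ (*-comm _ _)
  ⊛-comm F G (suc n) = begin
    F 0 * G (suc n) + (F ∘ suc ⊛ G) n  ≈⟨ +-cong (*-comm _ _) (⊛-comm (F ∘ suc) G n) ⟩
    G (suc n) * F 0 + (G ⊛ F ∘ suc) n  ≈⟨ ⊛-sucʳ G F n ⟨
    (G ⊛ F) (suc n)                    ∎

  ⊛-distribʳ : ∀ H F G → (λ n → F n + G n) ⊛ H ≋ λ n → (F ⊛ H) n + (G ⊛ H) n
  ⊛-distribʳ H F G zero =
    solve 3 (λ f g h → (f :+ g) :* h :+ con 0 := (f :* h :+ con 0) :+ (g :* h :+ con 0))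
      refl (F 0) (G 0) (H 0)
  ⊛-distribʳ H F G (suc n) = begin
    (F 0 + G 0) * H (suc n) + ((λ n → F (suc n) + G (suc n)) ⊛ H) n
      ≈⟨ +-congˡ (⊛-distribʳ H (F ∘ suc) (G ∘ suc) n) ⟩
    (F 0 + G 0) * H (suc n) + ((F ∘ suc ⊛ H) n + (G ∘ suc ⊛ H) n)
      ≈⟨ solve 5 (λ f g h s t → (f :+ g) :* h :+ (s :+ t) := (f :* h :+ s) :+ (g :* h :+ t))
           refl (F 0) (G 0) (H (suc n)) _ _ ⟩
    (F ⊛ H) (suc n) + (G ⊛ H) (suc n)  ∎

  ⊛-distribˡ : ∀ H F G → H ⊛ (λ n → F n + G n) ≋ λ n → (H ⊛ F) n + (H ⊛ G) n
  ⊛-distribˡ H F G n = begin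
    (H ⊛ (λ n → F n + G n)) n  ≈⟨ ⊛-comm H (λ n → F n + G n) n ⟩
    ((λ n → F n + G n) ⊛ H) n  ≈⟨ ⊛-distribʳ H F G n ⟩
    (F ⊛ H) n + (G ⊛ H) n      ≈⟨ +-cong (⊛-comm F H n) (⊛-comm G H n) ⟩
    (H ⊛ F) n + (H ⊛ G) n      ∎

  ⊛-scaleˡ : ∀ a F G → (λ n → a * F n) ⊛ G ≋ λ n → a * (F ⊛ G) n
  ⊛-scaleˡ a F G zero =
    solve 3 (λ a f g → (a :* f) :* g :+ con 0 := a :* (f :* g :+ con 0))
      refl a (F 0) (G 0)
  ⊛-scaleˡ a F G (suc n) = begin
    (a * F 0) * G (suc n) + ((λ n → a * F (suc n)) ⊛ G) n
      ≈⟨ +-congˡ (⊛-scaleˡ a (F ∘ suc) G n) ⟩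
    (a * F 0) * G (suc n) + a * (F ∘ suc ⊛ G) n
      ≈⟨ solve 4 (λ a f g s → (a :* f) :* g :+ a :* s := a :* (f :* g :+ s))
           refl a (F 0) (G (suc n)) _ ⟩
    a * (F ⊛ G) (suc n)  ∎

  ⊛-assoc : ∀ F G H → (F ⊛ G) ⊛ H ≋ F ⊛ (G ⊛ H)
  ⊛-assoc F G H zero =
    solve 3 (λ f g h → (f :* g :+ con 0) :* h :+ con 0 := f :* (g :* h :+ con 0) :+ con 0)
      refl (F 0) (G 0) (H 0)
  ⊛-assoc F G H (suc n) = begin
    (F 0 * G 0 + 0#) * h + ((λ n → F 0 * G (suc n) + (F ∘ suc ⊛ G) n) ⊛ H) n
      ≈⟨ +-congˡ (⊛-distribʳ H (λ n → F 0 * G (suc n)) (F ∘ suc ⊛ G) n) ⟩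
    (F 0 * G 0 + 0#) * h + (((λ n → F 0 * G (suc n)) ⊛ H) n + ((F ∘ suc ⊛ G) ⊛ H) n)
      ≈⟨ +-congˡ (+-cong (⊛-scaleˡ (F 0) (G ∘ suc) H n) (⊛-assoc (F ∘ suc) G H n)) ⟩
    (F 0 * G 0 + 0#) * h + (F 0 * (G ∘ suc ⊛ H) n + (F ∘ suc ⊛ (G ⊛ H)) n)
      ≈⟨ solve 5 (λ f g h s t → (f :* g :+ con 0) :* h :+ (f :* s :+ t)
                             := f :* (g :* h :+ s) :+ t)
           refl (F 0) (G 0) h _ _ ⟩
    F 0 * (G ⊛ H) (suc n) + (F ∘ suc ⊛ (G ⊛ H)) n  ∎
    where h = H (suc n)

  ⊛-identityˡ : ∀ F → constant 1# ⊛ F ≋ F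
  ⊛-identityˡ F n = trans (constant-⊛ 1# F n) (*-identityˡ (F n))

  ⊛-isCommutativeRing : IsCommutativeRing _≋_ (λ F G n → F n + G n) _⊛_
                        (λ F n → - F n) (λ _ → 0#) (constant 1#)
  ⊛-isCommutativeRing = record
    { isRing = record
      { +-isAbelianGroup = Pointwise.isAbelianGroup ℕ +-isAbelianGroup
      ; *-cong           = ⊛-cong
      ; *-assoc          = ⊛-assoc
      ; *-identity       = ⊛-identityˡ
                         , λ F n → trans (⊛-comm F (constant 1#) n) (⊛-identityˡ F n)
      ; distrib          = ⊛-distribˡ , ⊛-distribʳ
      }
    ; *-comm = ⊛-comm
    }

  powerSeriesRing : CommutativeRing c ℓ
  powerSeriesRing = record { isCommutativeRing = ⊛-isCommutativeRing }

  indeterminate : ℕ → Carrier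
  indeterminate zero    = 0#
  indeterminate (suc n) = constant 1# n

  indeterminate-⊛-zero : ∀ F → (indeterminate ⊛ F) 0 ≈ 0#
  indeterminate-⊛-zero F = trans (+-identityʳ _) (zeroˡ _)

  indeterminate-⊛-suc : ∀ F n → (indeterminate ⊛ F) (suc n) ≈ F n
  indeterminate-⊛-suc F n = begin
    0# * F (suc n) + (constant 1# ⊛ F) n  ≈⟨ +-cong (zeroˡ _) (⊛-identityˡ F n) ⟩
    0# + F n                              ≈⟨ +-identityˡ _ ⟩
    F n                                   ∎

  -- Once `G 0` and `H 0` agree, removing the summand they contribute leaves the same equation for
  -- the tails, so induction applies. The assumption on `F 0` has the same shape as the conclusion,
  -- so the lemma can feed itself when power series are iterated.
  ⊛-cancelˡ : ∀ F → (∀ a b → F 0 * a ≈ F 0 * b → a ≈ b) →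
              ∀ G H → F ⊛ G ≋ F ⊛ H → G ≋ H
  ⊛-cancelˡ F cancel₀ G H FG≋FH zero = cancel₀ _ _ (begin
    F 0 * G 0       ≈⟨ +-identityʳ _ ⟨
    F 0 * G 0 + 0#  ≈⟨ FG≋FH 0 ⟩
    F 0 * H 0 + 0#  ≈⟨ +-identityʳ _ ⟩
    F 0 * H 0       ∎)
  ⊛-cancelˡ F cancel₀ G H FG≋FH (suc n) =
    ⊛-cancelˡ F cancel₀ (G ∘ suc) (H ∘ suc) tails n
    where
    G₀≈H₀ = ⊛-cancelˡ F cancel₀ G H FG≋FH 0
    tails : F ⊛ (G ∘ suc) ≋ F ⊛ (H ∘ suc)
    tails n = ∙-cancelˡ (F (suc n) * G 0) _ _ (begin
      F (suc n) * G 0 + (F ⊛ G ∘ suc) n  ≈⟨ ⊛-sucʳ F G n ⟨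
      (F ⊛ G) (suc n)                    ≈⟨ FG≋FH (suc n) ⟩
      (F ⊛ H) (suc n)                    ≈⟨ ⊛-sucʳ F H n ⟩
      F (suc n) * H 0 + (F ⊛ H ∘ suc) n  ≈⟨ +-congʳ (*-congˡ G₀≈H₀) ⟨
      F (suc n) * G 0 + (F ⊛ H ∘ suc) n  ∎)

-- Weighted enumeration of trees

open import Defs using
  (Tree; node; IsSchroeder; isSchroeder?; leaves; leaves*; vertices; vertices*; forests)

module ListSum {c ℓ} (A : CommutativeRing c ℓ) where

  open CommutativeRing A
  open ≈-Reasoning setoid

  ∑ : ∀ {b} {B : Set b} → (B → Carrier) → List B → Carrier
  ∑ f []       = 0#
  ∑ f (b ∷ bs) = f b + ∑ f bs

  module _ {b} {B : Set b} where

    ∑-++ : ∀ (f : B → Carrier) bs bs′ → ∑ f (bs ++ bs′) ≈ ∑ f bs + ∑ f bs′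
    ∑-++ f []       bs′ = sym (+-identityˡ _)
    ∑-++ f (b ∷ bs) bs′ = trans (+-congˡ (∑-++ f bs bs′)) (sym (+-assoc _ _ _))

    ∑-map : ∀ {a} {A : Set a} (f : B → Carrier) {g : A → B} {h a} →
            (∀ b → f (g b) ≈ a * h b) → ∀ bs → ∑ f (map g bs) ≈ a * ∑ h bs
    ∑-map f f∘g≈ []       = sym (zeroʳ _)
    ∑-map f f∘g≈ (b ∷ bs) =
      trans (+-cong (f∘g≈ b) (∑-map f f∘g≈ bs)) (sym (distribˡ _ _ _))

  ∑-cartesianProductWith :
    ∀ {a b d} {A : Set a} {B : Set b} {D : Set d}
      (f : D → Carrier) {g : A → B → D} {h k} →
    (∀ a b → f (g a b) ≈ h a * k b) →
    ∀ as bs → ∑ f (cartesianProductWith g as bs) ≈ ∑ h as * ∑ k bs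
  ∑-cartesianProductWith f f∘g≈ []       bs = sym (zeroˡ _)
  ∑-cartesianProductWith f {g} {h} {k} f∘g≈ (a ∷ as) bs = begin
    ∑ f (map (g a) bs ++ cartesianProductWith g as bs)
      ≈⟨ ∑-++ f (map (g a) bs) _ ⟩
    ∑ f (map (g a) bs) + ∑ f (cartesianProductWith g as bs)
      ≈⟨ +-cong (∑-map f (f∘g≈ a) bs) (∑-cartesianProductWith f f∘g≈ as bs) ⟩
    h a * ∑ k bs + ∑ h as * ∑ k bs
      ≈⟨ distribʳ _ _ _ ⟨
    (h a + ∑ h as) * ∑ k bs  ∎

module Weights {c ℓ} (A : CommutativeRing c ℓ) (x y : CommutativeRing.Carrier A) where

  open CommutativeRing A
  open ListSum A
  open import Algebra.Properties.Semiring.Exp semiring using (_^_; ^-homo-*)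
  open NaturalSolver commutativeSemiring using (solve; _:*_; _:=_)
  open ≈-Reasoning setoid

  -- weight⁺ ts is the factor that the later siblings ts of a first child, together
  -- with their parent, contribute; it is 0 on [] since one child is not allowed.
  weight  : Tree → Carrier
  weight⁺ : List Tree → Carrier
  weight* : List Tree → Carrier
  weight (node [])       = x * y
  weight (node (t ∷ ts)) = weight t * weight⁺ ts
  weight⁺ []             = 0#
  weight⁺ (t ∷ ts)       = y * weight t * weight* ts
  weight* []             = 1#
  weight* (t ∷ ts)       = weight t * weight* ts

  -- From two children on, the asymmetric treatment of the first child disappears: the root gives
  -- `y` and every subtree its own weight.
  weight-node : ∀ t u us → weight (node (t ∷ u ∷ us)) ≈ y * weight* (t ∷ u ∷ us)
  weight-node t u us =
    solve 4 (λ y t u us → t :* (y :* u :* us) := y :* (t :* (u :* us))) refl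
      y (weight t) (weight u) (weight* us)

  private
    y*monomial : ∀ m n → y * (x ^ m * y ^ n) ≈ x ^ m * y ^ suc n
    y*monomial m n =
      solve 3 (λ y a b → y :* (a :* b) := a :* (y :* b)) refl y (x ^ m) (y ^ n)

  -- The recursive weight is the expected monomial on Schroeder trees and, by `weight-¬schroeder`,
  -- zero on all others. Sums over the unfiltered `forests d` therefore count Schroeder trees only.
  weight-schroeder  : ∀ {t} → IsSchroeder t → weight t ≈ x ^ leaves t * y ^ vertices t
  weight*-schroeder : ∀ {ts} → All IsSchroeder ts → weight* ts ≈ x ^ leaves* ts * y ^ vertices* ts
  weight-schroeder {node []}           _                       =
    *-cong (sym (*-identityʳ x)) (sym (*-identityʳ y))
  weight-schroeder {node (_ ∷ [])}     (node (inj₁ ()) _)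
  weight-schroeder {node (_ ∷ [])}     (node (inj₂ (s≤s ())) _)
  weight-schroeder {node ts@(t ∷ u ∷ us)} (node _ all) = begin
    weight (node ts)                          ≈⟨ weight-node t u us ⟩
    y * weight* ts                            ≈⟨ *-congˡ (weight*-schroeder all) ⟩
    y * (x ^ leaves* ts * y ^ vertices* ts)   ≈⟨ y*monomial (leaves* ts) (vertices* ts) ⟩
    x ^ leaves* ts * y ^ suc (vertices* ts)   ∎
  weight*-schroeder []               = sym (*-identityˡ 1#)
  weight*-schroeder {t ∷ ts} (s ∷ all) = begin
    weight t * weight* ts
      ≈⟨ *-cong (weight-schroeder s) (weight*-schroeder all) ⟩
    (x ^ m * y ^ n) * (x ^ m′ * y ^ n′)
      ≈⟨ solve 4 (λ a b c d → (a :* b) :* (c :* d) := (a :* c) :* (b :* d)) refl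
           (x ^ m) (y ^ n) (x ^ m′) (y ^ n′) ⟩
    (x ^ m * x ^ m′) * (y ^ n * y ^ n′)
      ≈⟨ *-cong (^-homo-* x m m′) (^-homo-* y n n′) ⟨
    x ^ (m ℕ.+ m′) * y ^ (n ℕ.+ n′)  ∎
    where
    m  = leaves t
    m′ = leaves* ts
    n  = vertices t
    n′ = vertices* ts

  weight-¬schroeder  : ∀ {t} → ¬ IsSchroeder t → weight t ≈ 0#
  weight*-¬schroeder : ∀ {ts} → ¬ All IsSchroeder ts → weight* ts ≈ 0#
  weight-¬schroeder {node []}           ¬s = contradiction (node (inj₁ ≡.refl) []) ¬s
  weight-¬schroeder {node (t ∷ [])}     ¬s = zeroʳ _
  weight-¬schroeder {node (t ∷ u ∷ us)} ¬s = begin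
    weight (node (t ∷ u ∷ us))  ≈⟨ weight-node t u us ⟩
    y * weight* (t ∷ u ∷ us)    ≈⟨ *-congˡ (weight*-¬schroeder (¬s ∘ node (inj₂ (s≤s (s≤s z≤n))))) ⟩
    y * 0#                      ≈⟨ zeroʳ y ⟩
    0#                          ∎
  weight*-¬schroeder {[]}     ¬all = contradiction [] ¬all
  weight*-¬schroeder {t ∷ ts} ¬all with isSchroeder? t
  ... | yes s = trans (*-congˡ (weight*-¬schroeder (¬all ∘ (s ∷_)))) (zeroʳ _)
  ... | no ¬s = trans (*-congʳ (weight-¬schroeder ¬s)) (zeroˡ _)

  -- The same list of forests is read in three ways: as the children of a root, as the later
  -- siblings of a first child together with the parent, and as a plain sequence.
  T V P : ℕ → Carrier
  T d = ∑ (weight ∘ node) (forests d)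
  V d = ∑ weight⁺ (forests d)
  P d = ∑ weight* (forests d)

  -- The empty forest is the leaf. Any other forest is a pair, the children of its first tree and
  -- the later siblings, on which the weight factors by definition; hence the `refl`.
  T-suc : ∀ d → T (suc d) ≈ x * y + T d * V d
  T-suc d = +-congˡ
    (∑-cartesianProductWith (weight ∘ node) (λ us ts → refl) (forests d) (forests d))

  V-suc : ∀ d → V (suc d) ≈ y * (T d * P d)
  V-suc d = begin
    V (suc d)
      -- The empty forest contributes `weight⁺ [] = 0#`.
      ≈⟨ +-identityˡ _ ⟩
    ∑ weight⁺ (cartesianProductWith (λ us ts → node us ∷ ts) (forests d) (forests d))
      ≈⟨ ∑-cartesianProductWith weight⁺ (λ us ts → refl) (forests d) (forests d) ⟩
    ∑ (λ us → y * weight (node us)) (forests d) * P d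
      ≈⟨ *-congʳ (y*∑ (forests d)) ⟩
    y * T d * P d
      ≈⟨ *-assoc _ _ _ ⟩
    y * (T d * P d)  ∎
    where
    y*∑ : ∀ uss → ∑ (λ us → y * weight (node us)) uss ≈ y * ∑ (weight ∘ node) uss
    y*∑ []         = sym (zeroʳ y)
    y*∑ (us ∷ uss) = trans (+-congˡ (y*∑ uss)) (sym (distribˡ y _ _))

  P-suc : ∀ d → P (suc d) ≈ 1# + T d * P d
  P-suc d = +-congˡ
    (∑-cartesianProductWith weight* (λ us ts → refl) (forests d) (forests d))

  T-0 : T 0 ≈ x * y
  T-0 = +-identityʳ _

  V-0 : V 0 ≈ 0#
  V-0 = +-identityʳ _

  P-0 : P 0 ≈ 1#
  P-0 = +-identityʳ _

-- The quadratic equation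

module Quadratic {c ℓ} (A : CommutativeRing c ℓ) where

  open CommutativeRing A
  open NaturalSolver commutativeSemiring using (solve; _:+_; _:*_; _:=_; con)
  open import Algebra.Properties.Group +-group using (∙-cancelʳ; x≈z//y)
  open ≈-Reasoning setoid

  -- With `q = T * P` the equations read `T = x y + y T q` and `q = T (1 + q)`. Expanding one `q` in
  -- `y T q` gives `y T²` plus `T` times `y T q`, and adding `x y T` completes the last factor to
  -- `T` again. Nothing is divided by `1 - T`.
  quadratic-equation : ∀ x y T V P →
    T ≈ x * y + T * V → V ≈ y * (T * P) → P ≈ 1# + T * P →
    x * y + (y + 1#) * (T * T) ≈ (1# + x * y) * T
  quadratic-equation x y T V P T≈ V≈ P≈ = sym (begin
    (1# + x * y) * T
      ≈⟨ solve 3 (λ x y T → (con 1 :+ x :* y) :* T := T :+ x :* y :* T) refl x y T ⟩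
    T + x * y * T
      ≈⟨ +-congʳ T≈xy+yTq ⟩
    x * y + T * (y * q) + x * y * T
      ≈⟨ +-congʳ (+-congˡ (*-congˡ (*-congˡ (*-congˡ P≈)))) ⟩
    x * y + T * (y * (T * (1# + q))) + x * y * T
      ≈⟨ solve 4 (λ x y T q → x :* y :+ T :* (y :* (T :* (con 1 :+ q))) :+ x :* y :* T
                           := x :* y :+ y :* (T :* T) :+ T :* (x :* y :+ T :* (y :* q)))
           refl x y T q ⟩
    x * y + y * (T * T) + T * (x * y + T * (y * q))
      ≈⟨ +-congˡ (*-congˡ T≈xy+yTq) ⟨
    x * y + y * (T * T) + T * T
      ≈⟨ solve 3 (λ x y T → x :* y :+ y :* (T :* T) :+ T :* T
                         := x :* y :+ (y :+ con 1) :* (T :* T)) refl x y T ⟩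
    x * y + (y + 1#) * (T * T)  ∎)
    where
    q = T * P
    T≈xy+yTq : T ≈ x * y + T * (y * q)
    T≈xy+yTq = trans T≈ (+-congˡ (*-congˡ V≈))

  -- `two` and `four` are parameters because `const 2` and `const 4` equal sums of ones only
  -- coefficientwise. The trailing `* 1#` in `D` and `square` is what `_^_` leaves at exponent 2, so
  -- both match the theorem literally.
  module _ (x y two four T : Carrier)
           (two≈ : two ≈ 1# + 1#) (four≈ : four ≈ 1# + 1# + (1# + 1#))
           (quadratic : x * y + (y + 1#) * (T * T) ≈ (1# + x * y) * T) where

    private
      a b S D : Carrier
      a = 1# + x * y
      b = two * y + two
      S = a - b * T
      D = x * y * (x * y * 1#) + two * x * y + 1# - four * x * y * (y + 1#)

      two*b≈ : b ≈ (1# + 1#) * (y + 1#)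
      two*b≈ = begin
        two * y + two                    ≈⟨ +-cong (*-congʳ two≈) two≈ ⟩
        (1# + 1#) * y + (1# + 1#)
          ≈⟨ solve 1 (λ y → con 2 :* y :+ con 2 := con 2 :* (y :+ con 1)) refl y ⟩
        (1# + 1#) * (y + 1#)  ∎

    S+bT≈a : S + b * T ≈ a
    S+bT≈a = begin
      a - b * T + b * T        ≈⟨ +-assoc _ _ _ ⟩
      a + (- (b * T) + b * T)  ≈⟨ +-congˡ (-‿inverseˡ _) ⟩
      a + 0#                   ≈⟨ +-identityʳ _ ⟩
      a                        ∎

    -- Completing the square in the quadratic equation; (b T)² is added to both
    -- sides so that everything except D itself is a semiring expression.
    square : S * (S * 1#) ≈ D
    square = x≈z//y _ _ _ (∙-cancelʳ (b * T * (b * T)) _ _ (begin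
      S * (S * 1#) + four * x * y * (y + 1#) + b * T * (b * T)
        ≈⟨ +-cong (+-congˡ (*-congʳ (*-congʳ (*-congʳ four≈))))
             (*-cong (*-congʳ two*b≈) (*-congʳ two*b≈)) ⟩
      S * (S * 1#) + (1# + 1# + (1# + 1#)) * x * y * (y + 1#)
        + (1# + 1#) * (y + 1#) * T * ((1# + 1#) * (y + 1#) * T)
        ≈⟨ solve 4 (λ S x y T →
             S :* (S :* con 1) :+ (con 2 :+ con 2) :* x :* y :* (y :+ con 1)
               :+ con 2 :* (y :+ con 1) :* T :* (con 2 :* (y :+ con 1) :* T)
             := S :* S :+ con 4 :* (y :+ con 1) :* (x :* y :+ (y :+ con 1) :* (T :* T)))
             refl S x y T ⟩
      S * S + (1# + 1# + 1# + 1#) * (y + 1#) * (x * y + (y + 1#) * (T * T))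
        ≈⟨ +-congˡ (*-congˡ quadratic) ⟩
      S * S + (1# + 1# + 1# + 1#) * (y + 1#) * (a * T)
        ≈⟨ solve 4 (λ S y a T →
             S :* S :+ con 4 :* (y :+ con 1) :* (a :* T)
             := S :* S :+ con 2 :* a :* (con 2 :* (y :+ con 1) :* T))
             refl S y a T ⟩
      S * S + (1# + 1#) * a * ((1# + 1#) * (y + 1#) * T)
        -- With `u = b * T` and `a` written as `S + u`, the identity
        -- `S² + 2 (S + u) u = (S + u)² + u²` applies; afterwards `S + u` becomes `a` again.
        ≈⟨ +-congˡ (*-cong (*-congˡ (sym S+bT≈a)) (*-congʳ (sym two*b≈))) ⟩
      S * S + (1# + 1#) * (S + b * T) * (b * T)
        ≈⟨ solve 2 (λ S u → S :* S :+ con 2 :* (S :+ u) :* u := (S :+ u) :* (S :+ u) :+ u :* u)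
             refl S (b * T) ⟩
      (S + b * T) * (S + b * T) + b * T * (b * T)
        ≈⟨ +-congʳ (*-cong S+bT≈a S+bT≈a) ⟩
      a * a + b * T * (b * T)
        ≈⟨ +-congʳ (solve 2 (λ x y → (con 1 :+ x :* y) :* (con 1 :+ x :* y)
             := x :* y :* (x :* y :* con 1) :+ con 2 :* x :* y :+ con 1) refl x y) ⟩
      x * y * (x * y * 1#) + (1# + 1#) * x * y + 1# + b * T * (b * T)
        ≈⟨ +-congʳ (+-congʳ (+-congˡ (*-congʳ (*-congʳ two≈)))) ⟨
      x * y * (x * y * 1#) + two * x * y + 1# + b * T * (b * T)  ∎))

    solution : ∀ √D b⁻¹ → √D ≈ S → b * b⁻¹ ≈ 1# → T ≈ (a - √D) * b⁻¹
    solution √D b⁻¹ √D≈S bb⁻¹≈1 = sym (begin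
      (a - √D) * b⁻¹    ≈⟨ *-congʳ (x≈z//y (b * T) √D a bT+√D≈a) ⟨
      b * T * b⁻¹       ≈⟨ solve 3 (λ b T b⁻¹ → b :* T :* b⁻¹ := T :* (b :* b⁻¹)) refl b T b⁻¹ ⟩
      T * (b * b⁻¹)     ≈⟨ *-congˡ bb⁻¹≈1 ⟩
      T * 1#            ≈⟨ *-identityʳ T ⟩
      T                 ∎)
      where
      bT+√D≈a : b * T + √D ≈ a
      bT+√D≈a = begin
        b * T + √D  ≈⟨ +-comm _ _ ⟩
        √D + b * T  ≈⟨ +-congʳ √D≈S ⟩
        S + b * T   ≈⟨ S+bT≈a ⟩
        a           ∎

  -- The difference of two squares without subtraction. The factor `S + T` remains to be cancelled.
  equal-squares : ∀ S T → S * (S * 1#) ≈ T * (T * 1#) → (S + T) * S ≈ (S + T) * T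
  equal-squares S T S²≈T² = begin
    (S + T) * S           ≈⟨ solve 2 (λ S T → (S :+ T) :* S := S :* (S :* con 1) :+ S :* T) refl S T ⟩
    S * (S * 1#) + S * T  ≈⟨ +-congʳ S²≈T² ⟩
    T * (T * 1#) + S * T  ≈⟨ solve 2 (λ S T → T :* (T :* con 1) :+ S :* T := (S :+ T) :* T) refl S T ⟩
    (S + T) * T           ∎

  -- The right-hand side involves only a shift and additions of coefficients, so a candidate inverse
  -- can be checked coefficient by coefficient.
  double : ∀ y two V → two ≈ 1# + 1# → (two * y + two) * V ≈ (y * V + V) + (y * V + V)
  double y two V two≈ = begin
    (two * y + two) * V                 ≈⟨ *-congʳ (+-cong (*-congʳ two≈) two≈) ⟩
    ((1# + 1#) * y + (1# + 1#)) * V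
      ≈⟨ solve 2 (λ y V → (con 2 :* y :+ con 2) :* V := (y :* V :+ V) :+ (y :* V :+ V)) refl y V ⟩
    (y * V + V) + (y * V + V)  ∎

open import Defs
open ≡ using (_≡_; refl; cong; cong₂; sym; trans)

-- The ring ℚ[[x,y]], as ℚ[[y]][[x]]

module Inner = PowerSeries ℚ.+-*-commutativeRing
module Outer = PowerSeries Inner.powerSeriesRing

open import Algebra.Properties.Semiring.Sum
  (CommutativeRing.semiring ℚ.+-*-commutativeRing) using (sum; sum-cong-≗)
open import Algebra.Properties.Semiring.Sum
  (CommutativeRing.semiring Inner.powerSeriesRing) using () renaming (sum to sum′)

sum-pointwise : ∀ {m} (f : Fin m → ℕ → ℚ) k → sum′ f k ≡ sum (λ i → f i k)
sum-pointwise {zero}  f k = refl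
sum-pointwise {suc m} f k = cong (f zero k ℚ.+_) (sum-pointwise (f ∘ suc) k)

⊗≈⊛ : ∀ F G → F ⊗ G ≈ F Outer.⊛ G
⊗≈⊛ F G n k = sym (sum-pointwise {suc n} (λ i → F (toℕ i) Inner.⊛ G (n ∸ toℕ i)) k)

const-1 : const 1 ≈ Outer.constant (Inner.constant 1ℚ)
const-1 zero    zero    = refl
const-1 zero    (suc k) = refl
const-1 (suc n) k       = refl

seriesRawRing : RawRing 0ℓ 0ℓ
seriesRawRing = record
  { Carrier = Series
  ; _≈_     = _≈_
  ; _+_     = _⊕_
  ; _*_     = _⊗_
  ; -_      = λ F n k → ℚ.- F n k
  ; 0#      = λ _ _ → 0ℚ
  ; 1#      = const 1
  }

-- The identity map pulls the ring laws back to the series of the statement. Only the product and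
-- the unit differ from the iterated construction, and only up to coefficientwise equality.
id-isRingMonomorphism :
  IsRingMonomorphism seriesRawRing (CommutativeRing.rawRing Outer.powerSeriesRing) id
id-isRingMonomorphism = record
  { isRingHomomorphism = record
    { isSemiringHomomorphism = record
      { isNearSemiringHomomorphism = record
        { +-isMonoidHomomorphism = record
          { isMagmaHomomorphism = record
            { isRelHomomorphism = record { cong = id }
            ; homo              = λ F G n k → refl
            }
          ; ε-homo = λ n k → refl
          }
        ; *-homo = ⊗≈⊛
        }
      ; 1#-homo = const-1
      }
    ; -‿homo = λ F n k → refl
    }
  ; injective = id
  }

seriesRing : CommutativeRing 0ℓ 0ℓ
seriesRing = record
  { isCommutativeRing = RingMonomorphism.isCommutativeRing id-isRingMonomorphism
                          Outer.⊛-isCommutativeRing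
  }

x≈ : x ≈ Outer.indeterminate
x≈ zero          k       = refl
x≈ (suc zero)    zero    = refl
x≈ (suc zero)    (suc k) = refl
x≈ (suc (suc n)) k       = refl

y≈ : y ≈ Outer.constant Inner.indeterminate
y≈ zero    zero          = refl
y≈ zero    (suc zero)    = refl
y≈ zero    (suc (suc k)) = refl
y≈ (suc n) k             = refl

x⊗≈ : ∀ F → x ⊗ F ≈ Outer.indeterminate Outer.⊛ F
x⊗≈ F n k = trans (⊗≈⊛ x F n k) (Outer.⊛-congʳ F x≈ n k)

x⊗-zero : ∀ F k → (x ⊗ F) 0 k ≡ 0ℚ
x⊗-zero F k = trans (x⊗≈ F 0 k) (Outer.indeterminate-⊛-zero F k)

x⊗-suc : ∀ F n k → (x ⊗ F) (suc n) k ≡ F n k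
x⊗-suc F n k = trans (x⊗≈ F (suc n) k) (Outer.indeterminate-⊛-suc F n k)

y⊗≈ : ∀ F → y ⊗ F ≈ λ n → Inner.indeterminate Inner.⊛ F n
y⊗≈ F n k = trans (⊗≈⊛ y F n k)
  (trans (Outer.⊛-congʳ F y≈ n k) (Outer.constant-⊛ Inner.indeterminate F n k))

y⊗-zero : ∀ F n → (y ⊗ F) n 0 ≡ 0ℚ
y⊗-zero F n = trans (y⊗≈ F n 0) (Inner.indeterminate-⊛-zero (F n))

y⊗-suc : ∀ F n k → (y ⊗ F) n (suc k) ≡ F n k
y⊗-suc F n k = trans (y⊗≈ F n (suc k)) (Inner.indeterminate-⊛-suc (F n) k)

-- Cancellation climbs two levels: the nonzero rational `F 0 0` cancels in ℚ, hence `F 0` in ℚ[[y]],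
-- hence `F` in ℚ[[x,y]].
⊗-cancelˡ : ∀ F → F 0 0 ≡.≢ 0ℚ → ∀ G H → F ⊗ G ≈ F ⊗ H → G ≈ H
⊗-cancelˡ F F₀₀≢0 G H FG≈FH =
  Outer.⊛-cancelˡ F (Inner.⊛-cancelˡ (F 0) cancel₀₀) G H λ n k →
    trans (sym (⊗≈⊛ F G n k)) (trans (FG≈FH n k) (⊗≈⊛ F H n k))
  where
  open ≡.≡-Reasoning
  instance _ = ℚ.≢-nonZero F₀₀≢0
  q = F 0 0
  cancel₀₀ : ∀ a b → q ℚ.* a ≡ q ℚ.* b → a ≡ b
  cancel₀₀ a b qa≡qb = begin
    a                          ≡⟨ ℚ.*-identityˡ a ⟨
    1ℚ ℚ.* a                   ≡⟨ cong (ℚ._* a) (ℚ.*-inverseˡ q) ⟨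
    ℚ.1/ q ℚ.* q ℚ.* a         ≡⟨ ℚ.*-assoc (ℚ.1/ q) q a ⟩
    ℚ.1/ q ℚ.* (q ℚ.* a)       ≡⟨ cong (ℚ.1/ q ℚ.*_) qa≡qb ⟩
    ℚ.1/ q ℚ.* (q ℚ.* b)       ≡⟨ ℚ.*-assoc (ℚ.1/ q) q b ⟨
    ℚ.1/ q ℚ.* q ℚ.* b         ≡⟨ cong (ℚ._* b) (ℚ.*-inverseˡ q) ⟩
    1ℚ ℚ.* b                   ≡⟨ ℚ.*-identityˡ b ⟩
    b                          ∎

open CommutativeRing seriesRing using
  (0#; 1#; *-assoc; *-comm; *-identityˡ; zeroˡ; zeroʳ; +-identityˡ; +-identityʳ)
  renaming (sym to ≈-sym; trans to ≈-trans)
open import Algebra.Properties.Semiring.Exp (CommutativeRing.semiring seriesRing)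
  using () renaming (_^_ to _^ˢ_)
open ListSum seriesRing using (∑)
open Weights seriesRing x y
open Quadratic seriesRing

-- Convergence in the y-adic topology

infix 4 _≈[_]_

-- Congruence modulo yᵐ; a record, so that F and G can be inferred from proofs.
record _≈[_]_ (F : Series) (m : ℕ) (G : Series) : Set where
  constructor modulo
  field coefficient : ∀ n k → k < m → F n k ≡ G n k

open _≈[_]_

≈[]-sym : ∀ {m F G} → F ≈[ m ] G → G ≈[ m ] F
≈[]-sym F≈G .coefficient n k k<m = sym (F≈G .coefficient n k k<m)

≈[]-trans : ∀ {m F G H} → F ≈[ m ] G → G ≈[ m ] H → F ≈[ m ] H
≈[]-trans F≈G G≈H .coefficient n k k<m =
  trans (F≈G .coefficient n k k<m) (G≈H .coefficient n k k<m)

≈⇒≈[] : ∀ {m F G} → F ≈ G → F ≈[ m ] G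
≈⇒≈[] F≈G .coefficient n k _ = F≈G n k

≈[]-refl : ∀ {m F} → F ≈[ m ] F
≈[]-refl .coefficient n k _ = refl

≈[]-weaken : ∀ {m m′ F G} → m ≤ m′ → F ≈[ m′ ] G → F ≈[ m ] G
≈[]-weaken m≤m′ F≈G .coefficient n k k<m = F≈G .coefficient n k (ℕ.<-≤-trans k<m m≤m′)

⊕-cong[] : ∀ {m F F′ G G′} → F ≈[ m ] F′ → G ≈[ m ] G′ → F ⊕ G ≈[ m ] F′ ⊕ G′
⊕-cong[] F≈ G≈ .coefficient n k k<m =
  cong₂ ℚ._+_ (F≈ .coefficient n k k<m) (G≈ .coefficient n k k<m)

⊕-congˡ[] : ∀ {m G G′} F → G ≈[ m ] G′ → F ⊕ G ≈[ m ] F ⊕ G′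
⊕-congˡ[] F = ⊕-cong[] (≈[]-refl {F = F})

-- The summands are compared, not the factors, so that a summand may also agree because one factor
-- vanishes.
⊗-coefficient-cong : ∀ F F′ G G′ n k →
  (∀ i j → j ≤ k → F i j ℚ.* G (n ∸ i) (k ∸ j) ≡ F′ i j ℚ.* G′ (n ∸ i) (k ∸ j)) →
  (F ⊗ G) n k ≡ (F′ ⊗ G′) n k
⊗-coefficient-cong F F′ G G′ n k eq =
  sum-cong-≗ {suc n} λ i → sum-cong-≗ {suc k} λ j → eq (toℕ i) (toℕ j) (toℕ≤pred[n] j)

⊗-cong[] : ∀ {m F F′ G G′} → F ≈[ m ] F′ → G ≈[ m ] G′ → F ⊗ G ≈[ m ] F′ ⊗ G′
⊗-cong[] {m} {F} {F′} {G} {G′} F≈ G≈ .coefficient n k k<m =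
  ⊗-coefficient-cong F F′ G G′ n k λ i j j≤k →
    cong₂ ℚ._*_ (F≈ .coefficient i j (ℕ.≤-<-trans j≤k k<m))
                (G≈ .coefficient (n ∸ i) (k ∸ j) (ℕ.≤-<-trans (ℕ.m∸n≤m k j) k<m))

⊗-congˡ[] : ∀ {m G G′} F → G ≈[ m ] G′ → F ⊗ G ≈[ m ] F ⊗ G′
⊗-congˡ[] F = ⊗-cong[] (≈[]-refl {F = F})

-- If `y` divides `F`, the coefficient of `yᵏ` in the product involves only coefficients of `G`
-- below `k`, so one order of precision is gained.
⊗-contract : ∀ {m F G G′} → F ≈[ 1 ] 0# → G ≈[ m ] G′ → F ⊗ G ≈[ suc m ] F ⊗ G′
⊗-contract {m} {F} {G} {G′} F≈0 G≈ .coefficient n k (s≤s k≤m) =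
  ⊗-coefficient-cong F F G G′ n k eq
  where
  eq : ∀ i j → j ≤ k → F i j ℚ.* G (n ∸ i) (k ∸ j) ≡ F i j ℚ.* G′ (n ∸ i) (k ∸ j)
  eq i zero    _   rewrite F≈0 .coefficient i 0 (s≤s z≤n) =
    trans (ℚ.*-zeroˡ (G (n ∸ i) k)) (sym (ℚ.*-zeroˡ (G′ (n ∸ i) k)))
  eq i (suc j) j<k = cong (F i (suc j) ℚ.*_)
    (G≈ .coefficient (n ∸ i) (k ∸ suc j) (ℕ.<-≤-trans (ℕ.∸-monoʳ-< {k} (s≤s z≤n) j<k) k≤m))

⊗-annihilate : ∀ {F} G → F ≈[ 1 ] 0# → F ⊗ G ≈[ 1 ] 0#
⊗-annihilate G F≈0 = ≈[]-trans (⊗-cong[] F≈0 (≈[]-refl {F = G})) (≈⇒≈[] (zeroˡ G))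

-- The diagonal: for a convergent sequence the coefficient of `yᵏ` no longer changes from stage `k`
-- on.
limit : (ℕ → Series) → Series
limit s n k = s k n k

Convergent : (ℕ → Series) → Set
Convergent s = ∀ d → s (suc d) ≈[ suc d ] s d

≈[]-limit : ∀ {s} → Convergent s → ∀ d → s d ≈[ suc d ] limit s
≈[]-limit {s} conv d .coefficient n k (s≤s k≤d) = go d k≤d
  where
  go : ∀ d → k ≤ d → s d n k ≡ s k n k
  go d       k≤d with ℕ.m≤n⇒m<n∨m≡n k≤d
  go d       k≤d | inj₂ refl = refl
  go (suc d) k≤d | inj₁ k<1+d@(s≤s k≤d′) =
    trans (conv d .coefficient n k k<1+d) (go d k≤d′)

-- The hypothesis concerns `s (suc d)` because the recurrences express stage `suc d` through stage
-- `d`.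
limit-unique : ∀ {s G} → Convergent s → (∀ d → s (suc d) ≈[ suc d ] G) → limit s ≈ G
limit-unique conv s≈G n k =
  trans (sym (conv k .coefficient n k (ℕ.n<1+n k))) (s≈G k .coefficient n k (ℕ.n<1+n k))

y≈0 : y ≈[ 1 ] 0#
y≈0 .coefficient zero    zero    _ = refl
y≈0 .coefficient (suc n) zero    _ = refl
y≈0 .coefficient n       (suc k) (s≤s ())

xy≈0 : x ⊗ y ≈[ 1 ] 0#
xy≈0 = ≈[]-trans (≈⇒≈[] (*-comm x y)) (⊗-annihilate x y≈0)

V≈0 : ∀ d → V d ≈[ 1 ] 0#
V≈0 zero    = ≈⇒≈[] V-0
V≈0 (suc d) = ≈[]-trans (≈⇒≈[] (V-suc d)) (⊗-annihilate (T d ⊗ P d) y≈0)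

T≈0 : ∀ d → T d ≈[ 1 ] 0#
T≈0 zero    = ≈[]-trans (≈⇒≈[] T-0) xy≈0
T≈0 (suc d) = ≈[]-trans (≈⇒≈[] (T-suc d))
  (≈[]-trans (⊕-cong[] xy≈0 (⊗-annihilate (V d) (T≈0 d))) (≈⇒≈[] (+-identityˡ 0#)))

-- A simultaneous induction. Each product in the recurrences has a factor divisible by `y`, which
-- raises the precision by one per stage. `T` and `V` are kept one order more precise than `P`.
T-step : ∀ d → T (suc d) ≈[ suc (suc d) ] T d
V-step : ∀ d → V (suc d) ≈[ suc (suc d) ] V d
P-step : ∀ d → P (suc d) ≈[ suc d ] P d

TP-step : ∀ d → T (suc d) ⊗ P (suc d) ≈[ suc (suc d) ] T d ⊗ P d
-- Replacing `P` gains an order from the factor `T`. Replacing `T` gains none, since `P d` is not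
-- divisible by `y`; here the extra order in `T-step` pays.
TP-step d = ≈[]-trans (⊗-contract (T≈0 (suc d)) (P-step d)) (⊗-cong[] (T-step d) (≈[]-refl {F = P d}))

T-step zero = ≈[]-trans (≈⇒≈[] (T-suc 0))
  (≈[]-trans (⊕-congˡ[] (x ⊗ y) T₀V₀≈0) (≈⇒≈[] (≈-trans (+-identityʳ (x ⊗ y)) (≈-sym T-0))))
  where
  T₀V₀≈0 : T 0 ⊗ V 0 ≈[ 2 ] 0#
  T₀V₀≈0 = ≈[]-trans (⊗-congˡ[] (T 0) (≈⇒≈[] V-0)) (≈⇒≈[] (zeroʳ (T 0)))
T-step (suc d) = ≈[]-trans (≈⇒≈[] (T-suc (suc d)))
  (≈[]-trans (⊕-congˡ[] (x ⊗ y) TV-step) (≈[]-sym (≈⇒≈[] (T-suc d))))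
  where
  TV-step : T (suc d) ⊗ V (suc d) ≈[ 3 ℕ.+ d ] T d ⊗ V d
  -- One factor is replaced at a time, and the other, divisible by `y`, supplies the additional
  -- order.
  TV-step = ≈[]-trans (⊗-contract (T≈0 (suc d)) (V-step d))
    (≈[]-trans (≈⇒≈[] (*-comm (T (suc d)) (V d)))
      (≈[]-trans (⊗-contract (V≈0 d) (T-step d)) (≈⇒≈[] (*-comm (V d) (T d)))))

V-step zero = ≈[]-trans (≈⇒≈[] (V-suc 0))
  (≈[]-trans (⊗-contract y≈0 (⊗-annihilate (P 0) (T≈0 0)))
    (≈⇒≈[] (≈-trans (zeroʳ y) (≈-sym V-0))))
V-step (suc d) = ≈[]-trans (≈⇒≈[] (V-suc (suc d)))
  (≈[]-trans (⊗-contract y≈0 (TP-step d)) (≈[]-sym (≈⇒≈[] (V-suc d))))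

P-step zero = ≈[]-trans (≈⇒≈[] (P-suc 0))
  (≈[]-trans (⊕-congˡ[] 1# (⊗-annihilate (P 0) (T≈0 0)))
    (≈⇒≈[] (≈-trans (+-identityʳ 1#) (≈-sym P-0))))
P-step (suc d) = ≈[]-trans (≈⇒≈[] (P-suc (suc d)))
  (≈[]-trans (⊕-congˡ[] 1# (TP-step d)) (≈[]-sym (≈⇒≈[] (P-suc d))))

T-convergent : Convergent T
T-convergent d = ≈[]-weaken (ℕ.n≤1+n _) (T-step d)

V-convergent : Convergent V
V-convergent d = ≈[]-weaken (ℕ.n≤1+n _) (V-step d)

T∞ V∞ P∞ : Series
T∞ = limit T
V∞ = limit V
P∞ = limit P

T∞≈ : T∞ ≈ x ⊗ y ⊕ T∞ ⊗ V∞
T∞≈ = limit-unique T-convergent λ d → ≈[]-trans (≈⇒≈[] (T-suc d))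
  (⊕-congˡ[] (x ⊗ y) (⊗-cong[] (≈[]-limit T-convergent d) (≈[]-limit V-convergent d)))

V∞≈ : V∞ ≈ y ⊗ (T∞ ⊗ P∞)
V∞≈ = limit-unique V-convergent λ d → ≈[]-trans (≈⇒≈[] (V-suc d))
  (⊗-congˡ[] y (⊗-cong[] (≈[]-limit T-convergent d) (≈[]-limit P-step d)))

P∞≈ : P∞ ≈ 1# ⊕ T∞ ⊗ P∞
P∞≈ = limit-unique P-step λ d → ≈[]-trans (≈⇒≈[] (P-suc d))
  (⊕-congˡ[] 1# (⊗-cong[] (≈[]-limit T-convergent d) (≈[]-limit P-step d)))

-- Coefficients

const-1-≢ : ∀ n k → ¬ (0 ≡ n × 0 ≡ k) → const 1 n k ≡ 0ℚ
const-1-≢ zero    zero    ≢ = contradiction (refl , refl) ≢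
const-1-≢ zero    (suc k) ≢ = refl
const-1-≢ (suc n) k       ≢ = refl

y^-≡ : ∀ b → (y ^ˢ b) 0 b ≡ 1ℚ
y^-≡ zero    = refl
y^-≡ (suc b) = trans (y⊗-suc (y ^ˢ b) 0 b) (y^-≡ b)

y^-≢ : ∀ b n k → ¬ (0 ≡ n × b ≡ k) → (y ^ˢ b) n k ≡ 0ℚ
y^-≢ zero    n k       ≢ = const-1-≢ n k ≢
y^-≢ (suc b) n zero    ≢ = y⊗-zero (y ^ˢ b) n
y^-≢ (suc b) n (suc k) ≢ = trans (y⊗-suc (y ^ˢ b) n k)
  (y^-≢ b n k λ (p , q) → ≢ (p , cong suc q))

monomial-≡ : ∀ a b → (x ^ˢ a ⊗ y ^ˢ b) a b ≡ 1ℚ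
monomial-≡ zero    b = trans (*-identityˡ (y ^ˢ b) 0 b) (y^-≡ b)
monomial-≡ (suc a) b = trans (*-assoc x (x ^ˢ a) (y ^ˢ b) (suc a) b)
  (trans (x⊗-suc (x ^ˢ a ⊗ y ^ˢ b) a b) (monomial-≡ a b))

monomial-≢ : ∀ a b n k → ¬ (a ≡ n × b ≡ k) → (x ^ˢ a ⊗ y ^ˢ b) n k ≡ 0ℚ
monomial-≢ zero    b n       k ≢ = trans (*-identityˡ (y ^ˢ b) n k) (y^-≢ b n k ≢)
monomial-≢ (suc a) b zero    k ≢ = trans (*-assoc x (x ^ˢ a) (y ^ˢ b) 0 k)
  (x⊗-zero (x ^ˢ a ⊗ y ^ˢ b) k)
monomial-≢ (suc a) b (suc n) k ≢ = trans (*-assoc x (x ^ˢ a) (y ^ˢ b) (suc n) k)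
  (trans (x⊗-suc (x ^ˢ a ⊗ y ^ˢ b) n k)
    (monomial-≢ a b n k λ (p , q) → ≢ (cong suc p , q)))

weight-≡ : ∀ {n k t} → SchroederWith n k t → weight t n k ≡ 1ℚ
weight-≡ {t = t} (s , refl , refl) =
  trans (weight-schroeder s (leaves t) (vertices t)) (monomial-≡ (leaves t) (vertices t))

weight-≢ : ∀ {n k t} → ¬ SchroederWith n k t → weight t n k ≡ 0ℚ
weight-≢ {n} {k} {t} ¬s with isSchroeder? t
... | yes s = trans (weight-schroeder s n k)
                (monomial-≢ (leaves t) (vertices t) n k (¬s ∘ (s ,_)))
... | no ¬s′ = weight-¬schroeder ¬s′ n k

-- Normalisation of `+ m ℚ./ 1` is stuck on a gcd for variable `m`. Among unnormalised rationals the
-- claim is an identity of integers.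
/1-suc : ∀ m → + suc m ℚ./ 1 ≡ 1ℚ ℚ.+ + m ℚ./ 1
/1-suc m = ℚ.toℚᵘ-injective (begin
  ℚ.toℚᵘ (+ suc m ℚ./ 1)             ≈⟨ ℚ.toℚᵘ-fromℚᵘ (ℚᵘ.mkℚᵘ (+ suc m) 0) ⟩
  ℚᵘ.mkℚᵘ (+ suc m) 0                ≈⟨ ℚᵘ.*≡* (cong (λ i → (+ 1 ℤ.+ i) ℤ.* + 1) (sym (ℤ.*-identityʳ (+ m)))) ⟩
  ℚᵘ.1ℚᵘ ℚᵘ.+ ℚᵘ.mkℚᵘ (+ m) 0        ≈⟨ ℚᵘ.+-congʳ ℚᵘ.1ℚᵘ (ℚ.toℚᵘ-fromℚᵘ (ℚᵘ.mkℚᵘ (+ m) 0)) ⟨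
  ℚᵘ.1ℚᵘ ℚᵘ.+ ℚ.toℚᵘ (+ m ℚ./ 1)     ≈⟨ ℚ.toℚᵘ-homo-+ 1ℚ (+ m ℚ./ 1) ⟨
  ℚ.toℚᵘ (1ℚ ℚ.+ + m ℚ./ 1)          ∎)
  where open ≈-Reasoning ℚᵘ.≃-setoid

-- Counting becomes summation, since the chosen coefficient of `f b` is the indicator of `Q b`.
length-filter-map : ∀ {A B : Set} {p} {Q : B → Set p} (Q? : Decidable Q)
  (f : B → Series) (g : A → B) n k →
  (∀ b → Q b → f b n k ≡ 1ℚ) → (∀ b → ¬ Q b → f b n k ≡ 0ℚ) →
  ∀ as → + length (filter Q? (map g as)) ℚ./ 1 ≡ ∑ (f ∘ g) as n k
length-filter-map Q? f g n k f≡1 f≡0 []       = refl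
length-filter-map Q? f g n k f≡1 f≡0 (a ∷ as) with Q? (g a)
... | yes q = trans (/1-suc (length (filter Q? (map g as))))
  (cong₂ ℚ._+_ (sym (f≡1 (g a) q)) (length-filter-map Q? f g n k f≡1 f≡0 as))
... | no ¬q = trans (sym (ℚ.+-identityˡ _))
  (cong₂ ℚ._+_ (sym (f≡0 (g a) ¬q)) (length-filter-map Q? f g n k f≡1 f≡0 as))

leaves-positive : ∀ t → leaves t ≡.≢ 0
leaves-positive (node [])       ()
leaves-positive (node (t ∷ ts)) eq = leaves-positive t (ℕ.m+n≡0⇒m≡0 (leaves t) eq)

r≡0 : ∀ n k → (∀ t → ¬ SchroederWith n k t) → r n k ≡ 0
r≡0 n k none = cong length
  (filter-none (schroederWith? n k) (All.universal none (map node (forests k))))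

R≈r : ∀ n k → R n k ≡ + r n k ℚ./ 1
R≈r zero    k       = cong (λ i → + i ℚ./ 1) (sym (r≡0 0 k λ t (_ , eq , _) → leaves-positive t eq))
R≈r (suc n) zero    = cong (λ i → + i ℚ./ 1) (sym (r≡0 (suc n) 0 λ { (node _) (_ , _ , ()) }))
R≈r (suc n) (suc k) = refl

-- By the diagonal definition, `T∞ n k` is a coefficient of a sum over `forests k`, the very list
-- that `schroederTrees n k` filters.
R≈T∞ : R ≈ T∞
R≈T∞ n k = trans (R≈r n k)
  (length-filter-map (schroederWith? n k) weight node n k
    (λ _ → weight-≡) (λ _ → weight-≢) (forests k))

-- Square root, inverse and closed form

quadratic : x ⊗ y ⊕ (y ⊕ const 1) ⊗ (T∞ ⊗ T∞) ≈ (const 1 ⊕ x ⊗ y) ⊗ T∞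
quadratic = quadratic-equation x y T∞ V∞ P∞ T∞≈ V∞≈ P∞≈

const-2 : const 2 ≈ const 1 ⊕ const 1
const-2 zero    zero    = refl
const-2 zero    (suc k) = refl
const-2 (suc n) k       = refl

const-4 : const 4 ≈ const 1 ⊕ const 1 ⊕ (const 1 ⊕ const 1)
const-4 zero    zero    = refl
const-4 zero    (suc k) = refl
const-4 (suc n) k       = refl

-- `√D₀` is the closed form solved for the root, so the quadratic equation for `T∞` provides both
-- the existence of the root and its value.
discriminant denominator √D₀ : Series
discriminant =
  (x ⊗ y) ^ 2 ⊕ const 2 ⊗ x ⊗ y ⊕ const 1 ⊖ const 4 ⊗ x ⊗ y ⊗ (y ⊕ const 1)
denominator = const 2 ⊗ y ⊕ const 2
√D₀ = const 1 ⊕ x ⊗ y ⊖ denominator ⊗ T∞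

√D₀-isSquareRoot : IsSquareRoot discriminant √D₀
-- The constant term is a closed rational, because `T∞ 0 0` unfolds to stage 0; it evaluates to 1.
√D₀-isSquareRoot = square x y (const 2) (const 4) T∞ const-2 const-4 quadratic , refl

-- Equal squares leave only a sign open. Both constant terms are 1, so `S ⊕ T` has constant term 2
-- and can be cancelled.
square-root-unique : ∀ F S T → IsSquareRoot F S → IsSquareRoot F T → S ≈ T
square-root-unique F S T (S²≈F , S₀≡1) (T²≈F , T₀≡1) =
  ⊗-cancelˡ (S ⊕ T) S+T≢0 S T
    (equal-squares S T (λ n k → trans (S²≈F n k) (sym (T²≈F n k))))
  where
  S+T≢0 : S 0 0 ℚ.+ T 0 0 ≡.≢ 0ℚ
  S+T≢0 rewrite S₀≡1 | T₀≡1 = λ ()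

-- The coefficients of `1 / (2 (1 + y))`, half the alternating geometric series.
geometric : ℕ → ℚ
geometric zero    = ½
geometric (suc k) = ℚ.- geometric k

B⁻¹₀ : Series
B⁻¹₀ zero    k = geometric k
B⁻¹₀ (suc n) k = 0ℚ

[1+y]B⁻¹₀ : ∀ n k → (y ⊗ B⁻¹₀ ⊕ B⁻¹₀) n k ℚ.+ (y ⊗ B⁻¹₀ ⊕ B⁻¹₀) n k ≡ const 1 n k
[1+y]B⁻¹₀ zero    zero    rewrite y⊗-zero B⁻¹₀ 0 = refl
[1+y]B⁻¹₀ zero    (suc k) rewrite y⊗-suc B⁻¹₀ 0 k | ℚ.+-inverseʳ (geometric k) = refl
[1+y]B⁻¹₀ (suc n) zero    rewrite y⊗-zero B⁻¹₀ (suc n) = refl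
[1+y]B⁻¹₀ (suc n) (suc k) rewrite y⊗-suc B⁻¹₀ (suc n) k = refl

B⁻¹₀-isInverse : IsInverse denominator B⁻¹₀
B⁻¹₀-isInverse n k =
  trans (double y (const 2) B⁻¹₀ const-2 n k) ([1+y]B⁻¹₀ n k)

inverse-unique : ∀ F V W → F 0 0 ≡.≢ 0ℚ → IsInverse F V → IsInverse F W → V ≈ W
inverse-unique F V W F₀≢0 FV≈1 FW≈1 =
  ⊗-cancelˡ F F₀≢0 V W λ n k → trans (FV≈1 n k) (sym (FW≈1 n k))

lemma3p2 :
    let D = (x ⊗ y) ^ 2 ⊕ const 2 ⊗ x ⊗ y ⊕ const 1 ⊖ const 4 ⊗ x ⊗ y ⊗ (y ⊕ const 1)
        B = const 2 ⊗ y ⊕ const 2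
    in ∃! _≈_ (IsSquareRoot D)
       × ∃! _≈_ (IsInverse B)
       × (∀ √D B⁻¹ → IsSquareRoot D √D → IsInverse B B⁻¹ →
            R ≈ (const 1 ⊕ x ⊗ y ⊖ √D) ⊗ B⁻¹)
lemma3p2 =
    (√D₀ , √D₀-isSquareRoot , λ {S} → square-root-unique discriminant √D₀ S √D₀-isSquareRoot)
  , (B⁻¹₀ , B⁻¹₀-isInverse , λ {V} → inverse-unique denominator B⁻¹₀ V (λ ()) B⁻¹₀-isInverse)
  , λ √D B⁻¹ √D-isSquareRoot BB⁻¹≈1 n k → trans (R≈T∞ n k)
      (solution x y (const 2) (const 4) T∞ const-2 const-4 quadratic √D B⁻¹
        (square-root-unique discriminant √D √D₀ √D-isSquareRoot √D₀-isSquareRoot) BB⁻¹≈1 n k)
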